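{- $I_{\mathrm S}\supseteq I_{\mathrm C}$.
   Context: $\mathcal U=\mathbb Z\langle u_1,\dots,u_N\rangle$ is the free associative ring on noncommuting generators; ideals are two-sided. $I_{\mathrm C}$ is the ideal generated by $u_b^2u_a+u_au_bu_a-u_bu_au_b-u_bu_a^2$ ($a<b$); $u_bu_cu_a+u_au_cu_b-u_bu_au_c-u_cu_au_b$ ($a<b<c$); $u_cu_bu_cu_a+u_bu_cu_au_c-u_cu_bu_au_c-u_bu_c^2u_a$ ($a<b<c$). The switchboard ideal $I_{\mathrm S}$ is the ideal generated by $u_b^2u_a+u_au_bu_a-u_bu_au_b-u_bu_a^2$ ($b-a=1$); $u_b^2u_a-u_bu_au_b$ ($b-a\ge2$); $u_bu_a^2-u_au_bu_a$ ($b-a\ge2$); $u_bu_cu_a+u_au_cu_b-u_bu_au_c-u_cu_au_b$ ($a<b<c$). Indices range over $\{1,\dots,N\}$. -}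

module Defs where

open import Data.Nat using (ℕ; suc; _+_; _≤_)
open import Data.Fin using (Fin; toℕ; _<_)
open import Relation.Binary.PropositionalEquality using (_≡_)

infixl 6 _⊕_ _⊝_
infixl 7 _⊗_
infix 4 _≈_

data Expr (N : ℕ) : Set where
  u    : Fin N → Expr N
  𝟘 𝟙  : Expr N
  _⊕_  : Expr N → Expr N → Expr N
  _⊗_  : Expr N → Expr N → Expr N
  ⊖_   : Expr N → Expr N

_⊝_ : ∀ {N} → Expr N → Expr N → Expr N
p ⊝ q = p ⊕ (⊖ q)

-- The ring axioms: Expr N / ≈ is the free associative (unital) ring
-- ℤ⟨u_1,…,u_N⟩ (the initial ring with N distinguished elements).
data _≈_ {N : ℕ} : Expr N → Expr N → Set where
  ≈-refl  : ∀ {p} → p ≈ p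
  ≈-sym   : ∀ {p q} → p ≈ q → q ≈ p
  ≈-trans : ∀ {p q r} → p ≈ q → q ≈ r → p ≈ r
  ⊕-cong  : ∀ {p p′ q q′} → p ≈ p′ → q ≈ q′ → p ⊕ q ≈ p′ ⊕ q′
  ⊗-cong  : ∀ {p p′ q q′} → p ≈ p′ → q ≈ q′ → p ⊗ q ≈ p′ ⊗ q′
  ⊖-cong  : ∀ {p p′} → p ≈ p′ → ⊖ p ≈ ⊖ p′
  ⊕-assoc : ∀ p q r → (p ⊕ q) ⊕ r ≈ p ⊕ (q ⊕ r)
  ⊕-comm  : ∀ p q → p ⊕ q ≈ q ⊕ p
  ⊕-idˡ   : ∀ p → 𝟘 ⊕ p ≈ p
  ⊖-invˡ  : ∀ p → (⊖ p) ⊕ p ≈ 𝟘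
  ⊗-assoc : ∀ p q r → (p ⊗ q) ⊗ r ≈ p ⊗ (q ⊗ r)
  ⊗-idˡ   : ∀ p → 𝟙 ⊗ p ≈ p
  ⊗-idʳ   : ∀ p → p ⊗ 𝟙 ≈ p
  distribˡ : ∀ p q r → p ⊗ (q ⊕ r) ≈ (p ⊗ q) ⊕ (p ⊗ r)
  distribʳ : ∀ p q r → (q ⊕ r) ⊗ p ≈ (q ⊗ p) ⊕ (r ⊗ p)

data ⟨_⟩ {N : ℕ} (G : Expr N → Set) : Expr N → Set where
  gen   : ∀ {g} → G g → ⟨ G ⟩ g
  zero∈ : ⟨ G ⟩ 𝟘
  add∈  : ∀ {p q} → ⟨ G ⟩ p → ⟨ G ⟩ q → ⟨ G ⟩ (p ⊕ q)
  neg∈  : ∀ {p} → ⟨ G ⟩ p → ⟨ G ⟩ (⊖ p)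
  mulˡ∈ : ∀ {p} (r : Expr N) → ⟨ G ⟩ p → ⟨ G ⟩ (r ⊗ p)
  mulʳ∈ : ∀ {p} (r : Expr N) → ⟨ G ⟩ p → ⟨ G ⟩ (p ⊗ r)
  resp∈ : ∀ {p q} → p ≈ q → ⟨ G ⟩ p → ⟨ G ⟩ q

rel1 : ∀ {N} → Fin N → Fin N → Expr N
rel1 a b = u b ⊗ u b ⊗ u a ⊕ u a ⊗ u b ⊗ u a ⊝ u b ⊗ u a ⊗ u b ⊝ u b ⊗ u a ⊗ u a

rel3 : ∀ {N} → Fin N → Fin N → Fin N → Expr N
rel3 a b c = u b ⊗ u c ⊗ u a ⊕ u a ⊗ u c ⊗ u b ⊝ u b ⊗ u a ⊗ u c ⊝ u c ⊗ u a ⊗ u b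

rel4 : ∀ {N} → Fin N → Fin N → Fin N → Expr N
rel4 a b c = u c ⊗ u b ⊗ u c ⊗ u a ⊕ u b ⊗ u c ⊗ u a ⊗ u c
             ⊝ u c ⊗ u b ⊗ u a ⊗ u c ⊝ u b ⊗ u c ⊗ u c ⊗ u a

data GenC {N : ℕ} : Expr N → Set where
  c1 : ∀ {a b} → a < b → GenC (rel1 a b)
  c2 : ∀ {a b c} → a < b → b < c → GenC (rel3 a b c)
  c3 : ∀ {a b c} → a < b → b < c → GenC (rel4 a b c)

data GenS {N : ℕ} : Expr N → Set where
  s1 : ∀ {a b} → toℕ b ≡ suc (toℕ a) → GenS (rel1 a b)
  s2 : ∀ {a b} → toℕ a + 2 ≤ toℕ b → GenS (u b ⊗ u b ⊗ u a ⊝ u b ⊗ u a ⊗ u b)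
  s3 : ∀ {a b} → toℕ a + 2 ≤ toℕ b → GenS (u b ⊗ u a ⊗ u a ⊝ u a ⊗ u b ⊗ u a)
  s4 : ∀ {a b c} → a < b → b < c → GenS (rel3 a b c)

I-C : ∀ N → Expr N → Set
I-C N = ⟨ GenC {N} ⟩

I-S : ∀ N → Expr N → Set
I-S N = ⟨ GenS {N} ⟩

-- For b − a = 1 the first generator of I_C is a generator of I_S; for b − a ≥ 2 it is
-- u_b(u_b u_a − u_a u_b) − (u_b u_a − u_a u_b)u_a, a difference of two generators of I_S.
-- The second family of generators is common to both ideals. For the third, g = u_c² u_a − u_c u_a u_c
-- lies in I_S because c − a ≥ 2, and in the free ring
--   u_c u_b u_c u_a + u_b u_c u_a u_c − u_c u_b u_a u_c − u_b u_c² u_a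
--     = g u_b − u_b g + u_c (u_b u_c u_a + u_a u_c u_b − u_b u_a u_c − u_c u_a u_b).
-- Such identities are verified by expanding into signed words and cancelling opposite terms.
module Submission where

open import Defs
open import Data.Nat using (ℕ; suc; _≤_; s≤s)
import Data.Nat as ℕ
open import Data.Nat.Properties using (≤-trans; ≤-reflexive; +-comm; ≤∧≢⇒<; _≟_)
open import Data.Fin using (Fin; toℕ; _<_; #_)
import Data.Fin.Properties as Fin
open import Data.Sign as Sign using (Sign; opposite) renaming (_*_ to _*ˢ_)
open import Data.Sign.Properties using () renaming (_≟_ to _≟ˢ_)
open import Data.List using (List; []; _∷_; _++_; map; foldr)
import Data.List.Properties as List
open import Data.Product using (_×_; _,_)
open import Data.Product.Properties using (≡-dec)
open import Data.Vec using (lookup) renaming ([] to ⟨⟩; _∷_ to _∷ᵛ_)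
open import Function using (_∘_)
open import Level using (0ℓ)
open import Relation.Nullary using (yes; no)
open import Relation.Unary using (_⊆_)
open import Relation.Binary using (Setoid; DecidableEquality)
open import Relation.Binary.PropositionalEquality as ≡ using (_≡_)
open import Algebra.Bundles using (Ring)
import Algebra.Consequences.Setoid as Consequences

private
  variable
    n : ℕ

Word : ℕ → Set
Word n = List (Fin n)

Monomial : ℕ → Set
Monomial n = Sign × Word n

Polynomial : ℕ → Set
Polynomial n = List (Monomial n)

infix 4 _≟ᴹ_
infix 8 -ᴹ_
infixl 7 _*ᴹ_ _*ᴾ_

_≟ᴹ_ : DecidableEquality (Monomial n)
_≟ᴹ_ = ≡-dec _≟ˢ_ (List.≡-dec Fin._≟_)

-ᴹ_ : Monomial n → Monomial n
-ᴹ (s , w) = opposite s , w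

_*ᴹ_ : Monomial n → Monomial n → Monomial n
(s , w) *ᴹ (t , v) = s *ˢ t , w ++ v

_*ᴾ_ : Polynomial n → Polynomial n → Polynomial n
[] *ᴾ ys = []
(x ∷ xs) *ᴾ ys = map (x *ᴹ_) ys ++ xs *ᴾ ys

expand : Expr n → Polynomial n
expand (u i) = (Sign.+ , i ∷ []) ∷ []
expand 𝟘 = []
expand 𝟙 = (Sign.+ , []) ∷ []
expand (p ⊕ q) = expand p ++ expand q
expand (p ⊗ q) = expand p *ᴾ expand q
expand (⊖ p) = map -ᴹ_ (expand p)

addMonomial : Monomial n → Polynomial n → Polynomial n
addMonomial m [] = m ∷ []
addMonomial m (x ∷ xs) with x ≟ᴹ -ᴹ m
... | yes _ = xs
... | no _ = x ∷ addMonomial m xs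

normalise : Expr n → Polynomial n
normalise = foldr addMonomial [] ∘ expand

module FreeRingSolver {c ℓ} (R : Ring c ℓ) where

  open Ring R renaming (_≈_ to _≈ᴿ_; distribˡ to *-distribˡ-+; distribʳ to *-distribʳ-+)
  open import Algebra.Properties.Ring R
  open import Algebra.Properties.CommutativeSemigroup +-commutativeSemigroup using (x∙yz≈y∙xz)
  open import Relation.Binary.Reasoning.Setoid setoid

  ⟦_⟧ : Expr n → (Fin n → Carrier) → Carrier
  ⟦ u i ⟧ ρ = ρ i
  ⟦ 𝟘 ⟧ ρ = 0#
  ⟦ 𝟙 ⟧ ρ = 1#
  ⟦ p ⊕ q ⟧ ρ = ⟦ p ⟧ ρ + ⟦ q ⟧ ρ
  ⟦ p ⊗ q ⟧ ρ = ⟦ p ⟧ ρ * ⟦ q ⟧ ρ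
  ⟦ ⊖ p ⟧ ρ = - ⟦ p ⟧ ρ

  signed : Sign → Carrier → Carrier
  signed Sign.+ x = x
  signed Sign.- x = - x

  signed-opposite : ∀ s x → signed (opposite s) x ≈ᴿ - signed s x
  signed-opposite Sign.+ x = refl
  signed-opposite Sign.- x = sym (-‿involutive x)

  -x*-y≈x*y : ∀ x y → - x * - y ≈ᴿ x * y
  -x*-y≈x*y x y = begin
    - x * - y     ≈⟨ -‿distribʳ-* (- x) y ⟨
    - (- x * y)   ≈⟨ -‿cong (-‿distribˡ-* x y) ⟨
    - - (x * y)   ≈⟨ -‿involutive (x * y) ⟩
    x * y         ∎

  signed-cong : ∀ s {x y} → x ≈ᴿ y → signed s x ≈ᴿ signed s y
  signed-cong Sign.+ x≈y = x≈y
  signed-cong Sign.- x≈y = -‿cong x≈y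

  signed-* : ∀ s t x y → signed (s *ˢ t) (x * y) ≈ᴿ signed s x * signed t y
  signed-* Sign.+ Sign.+ x y = refl
  signed-* Sign.+ Sign.- x y = -‿distribʳ-* x y
  signed-* Sign.- Sign.+ x y = -‿distribˡ-* x y
  signed-* Sign.- Sign.- x y = sym (-x*-y≈x*y x y)

  module Denotation (ρ : Fin n → Carrier) where

    ⟦_⟧ʷ : Word n → Carrier
    ⟦ [] ⟧ʷ = 1#
    ⟦ i ∷ w ⟧ʷ = ρ i * ⟦ w ⟧ʷ

    ⟦_⟧ᴹ : Monomial n → Carrier
    ⟦ s , w ⟧ᴹ = signed s ⟦ w ⟧ʷ

    ⟦_⟧ᴾ : Polynomial n → Carrier
    ⟦ [] ⟧ᴾ = 0#
    ⟦ m ∷ ms ⟧ᴾ = ⟦ m ⟧ᴹ + ⟦ ms ⟧ᴾ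

    ⟦++⟧ʷ : ∀ w v → ⟦ w ++ v ⟧ʷ ≈ᴿ ⟦ w ⟧ʷ * ⟦ v ⟧ʷ
    ⟦++⟧ʷ [] v = sym (*-identityˡ _)
    ⟦++⟧ʷ (i ∷ w) v = trans (*-congˡ (⟦++⟧ʷ w v)) (sym (*-assoc _ _ _))

    ⟦-ᴹ⟧ : ∀ m → ⟦ -ᴹ m ⟧ᴹ ≈ᴿ - ⟦ m ⟧ᴹ
    ⟦-ᴹ⟧ (s , w) = signed-opposite s ⟦ w ⟧ʷ

    ⟦*ᴹ⟧ : ∀ m m′ → ⟦ m *ᴹ m′ ⟧ᴹ ≈ᴿ ⟦ m ⟧ᴹ * ⟦ m′ ⟧ᴹ
    ⟦*ᴹ⟧ (s , w) (t , v) = trans (signed-cong (s *ˢ t) (⟦++⟧ʷ w v)) (signed-* s t _ _)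

    ⟦++⟧ᴾ : ∀ xs ys → ⟦ xs ++ ys ⟧ᴾ ≈ᴿ ⟦ xs ⟧ᴾ + ⟦ ys ⟧ᴾ
    ⟦++⟧ᴾ [] ys = sym (+-identityˡ _)
    ⟦++⟧ᴾ (x ∷ xs) ys = trans (+-congˡ (⟦++⟧ᴾ xs ys)) (sym (+-assoc _ _ _))

    ⟦map-ᴹ⟧ : ∀ xs → ⟦ map -ᴹ_ xs ⟧ᴾ ≈ᴿ - ⟦ xs ⟧ᴾ
    ⟦map-ᴹ⟧ [] = sym -0#≈0#
    ⟦map-ᴹ⟧ (x ∷ xs) = trans (+-cong (⟦-ᴹ⟧ x) (⟦map-ᴹ⟧ xs)) (-‿+-comm _ _)

    ⟦map*ᴹ⟧ : ∀ m ys → ⟦ map (m *ᴹ_) ys ⟧ᴾ ≈ᴿ ⟦ m ⟧ᴹ * ⟦ ys ⟧ᴾ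
    ⟦map*ᴹ⟧ m [] = sym (zeroʳ _)
    ⟦map*ᴹ⟧ m (y ∷ ys) = trans (+-cong (⟦*ᴹ⟧ m y) (⟦map*ᴹ⟧ m ys)) (sym (*-distribˡ-+ _ _ _))

    ⟦*ᴾ⟧ : ∀ xs ys → ⟦ xs *ᴾ ys ⟧ᴾ ≈ᴿ ⟦ xs ⟧ᴾ * ⟦ ys ⟧ᴾ
    ⟦*ᴾ⟧ [] ys = sym (zeroˡ _)
    ⟦*ᴾ⟧ (x ∷ xs) ys = begin
      ⟦ map (x *ᴹ_) ys ++ xs *ᴾ ys ⟧ᴾ        ≈⟨ ⟦++⟧ᴾ (map (x *ᴹ_) ys) (xs *ᴾ ys) ⟩
      ⟦ map (x *ᴹ_) ys ⟧ᴾ + ⟦ xs *ᴾ ys ⟧ᴾ    ≈⟨ +-cong (⟦map*ᴹ⟧ x ys) (⟦*ᴾ⟧ xs ys) ⟩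
      ⟦ x ⟧ᴹ * ⟦ ys ⟧ᴾ + ⟦ xs ⟧ᴾ * ⟦ ys ⟧ᴾ  ≈⟨ *-distribʳ-+ _ _ _ ⟨
      (⟦ x ⟧ᴹ + ⟦ xs ⟧ᴾ) * ⟦ ys ⟧ᴾ           ∎

    ⟦expand⟧ : ∀ p → ⟦ expand p ⟧ᴾ ≈ᴿ ⟦ p ⟧ ρ
    ⟦expand⟧ (u i) = trans (+-identityʳ _) (*-identityʳ _)
    ⟦expand⟧ 𝟘 = refl
    ⟦expand⟧ 𝟙 = +-identityʳ _
    ⟦expand⟧ (p ⊕ q) = trans (⟦++⟧ᴾ (expand p) (expand q)) (+-cong (⟦expand⟧ p) (⟦expand⟧ q))
    ⟦expand⟧ (p ⊗ q) = trans (⟦*ᴾ⟧ (expand p) (expand q)) (*-cong (⟦expand⟧ p) (⟦expand⟧ q))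
    ⟦expand⟧ (⊖ p) = trans (⟦map-ᴹ⟧ (expand p)) (-‿cong (⟦expand⟧ p))

    ⟦addMonomial⟧ : ∀ m xs → ⟦ addMonomial m xs ⟧ᴾ ≈ᴿ ⟦ m ⟧ᴹ + ⟦ xs ⟧ᴾ
    ⟦addMonomial⟧ m [] = refl
    ⟦addMonomial⟧ m (x ∷ xs) with x ≟ᴹ -ᴹ m
    ... | yes ≡.refl = begin
      ⟦ xs ⟧ᴾ                          ≈⟨ +-identityˡ _ ⟨
      0# + ⟦ xs ⟧ᴾ                     ≈⟨ +-congʳ (-‿inverseʳ _) ⟨
      (⟦ m ⟧ᴹ - ⟦ m ⟧ᴹ) + ⟦ xs ⟧ᴾ      ≈⟨ +-assoc _ _ _ ⟩
      ⟦ m ⟧ᴹ + (- ⟦ m ⟧ᴹ + ⟦ xs ⟧ᴾ)    ≈⟨ +-congˡ (+-congʳ (⟦-ᴹ⟧ m)) ⟨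
      ⟦ m ⟧ᴹ + (⟦ -ᴹ m ⟧ᴹ + ⟦ xs ⟧ᴾ)   ∎
    ... | no _ = begin
      ⟦ x ⟧ᴹ + ⟦ addMonomial m xs ⟧ᴾ   ≈⟨ +-congˡ (⟦addMonomial⟧ m xs) ⟩
      ⟦ x ⟧ᴹ + (⟦ m ⟧ᴹ + ⟦ xs ⟧ᴾ)      ≈⟨ x∙yz≈y∙xz _ _ _ ⟩
      ⟦ m ⟧ᴹ + (⟦ x ⟧ᴹ + ⟦ xs ⟧ᴾ)      ∎

    ⟦normalise⟧ : ∀ p → ⟦ normalise p ⟧ᴾ ≈ᴿ ⟦ p ⟧ ρ
    ⟦normalise⟧ p = trans (⟦foldr⟧ (expand p)) (⟦expand⟧ p)
      where
      ⟦foldr⟧ : ∀ xs → ⟦ foldr addMonomial [] xs ⟧ᴾ ≈ᴿ ⟦ xs ⟧ᴾ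
      ⟦foldr⟧ [] = refl
      ⟦foldr⟧ (m ∷ ms) = trans (⟦addMonomial⟧ m (foldr addMonomial [] ms)) (+-congˡ (⟦foldr⟧ ms))

  -- Normal forms are unordered lists, so an identity is tested as p − q ↦ [].
  solve : (p q : Expr n) → normalise (p ⊝ q) ≡ [] → ∀ ρ → ⟦ p ⟧ ρ ≈ᴿ ⟦ q ⟧ ρ
  solve p q p-q↦[] ρ = x∙y⁻¹≈ε⇒x≈y _ _ (begin
    ⟦ p ⊝ q ⟧ ρ               ≈⟨ ⟦normalise⟧ (p ⊝ q) ⟨
    ⟦ normalise (p ⊝ q) ⟧ᴾ    ≡⟨ ≡.cong ⟦_⟧ᴾ p-q↦[] ⟩
    0#                        ∎)
    where open Denotation ρ

≈-setoid : ℕ → Setoid 0ℓ 0ℓ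
≈-setoid N = record
  { Carrier = Expr N
  ; _≈_ = _≈_
  ; isEquivalence = record { refl = ≈-refl ; sym = ≈-sym ; trans = ≈-trans }
  }

Expr-ring : ℕ → Ring 0ℓ 0ℓ
Expr-ring N = record
  { Carrier = Expr N ; _≈_ = _≈_ ; _+_ = _⊕_ ; _*_ = _⊗_ ; -_ = ⊖_ ; 0# = 𝟘 ; 1# = 𝟙
  ; isRing = record
    { +-isAbelianGroup = record
      { isGroup = record
        { isMonoid = record
          { isSemigroup = record
            { isMagma = record { isEquivalence = Setoid.isEquivalence (≈-setoid N) ; ∙-cong = ⊕-cong }
            ; assoc = ⊕-assoc }
          ; identity = comm∧idˡ⇒id ⊕-comm ⊕-idˡ }
        ; inverse = comm∧invˡ⇒inv ⊕-comm ⊖-invˡ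
        ; ⁻¹-cong = ⊖-cong }
      ; comm = ⊕-comm }
    ; *-cong = ⊗-cong
    ; *-assoc = ⊗-assoc
    ; *-identity = ⊗-idˡ , ⊗-idʳ
    ; distrib = distribˡ , distribʳ } }
  where open Consequences (≈-setoid N)

⟨⟩-least : {G H : Expr n → Set} → G ⊆ ⟨ H ⟩ → ⟨ G ⟩ ⊆ ⟨ H ⟩
⟨⟩-least G⊆H (gen g) = G⊆H g
⟨⟩-least G⊆H zero∈ = zero∈
⟨⟩-least G⊆H (add∈ p q) = add∈ (⟨⟩-least G⊆H p) (⟨⟩-least G⊆H q)
⟨⟩-least G⊆H (neg∈ p) = neg∈ (⟨⟩-least G⊆H p)
⟨⟩-least G⊆H (mulˡ∈ r p) = mulˡ∈ r (⟨⟩-least G⊆H p)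
⟨⟩-least G⊆H (mulʳ∈ r p) = mulʳ∈ r (⟨⟩-least G⊆H p)
⟨⟩-least G⊆H (resp∈ p≈q p) = resp∈ p≈q (⟨⟩-least G⊆H p)

module _ {N : ℕ} where

  open FreeRingSolver (Expr-ring N) using (solve)

  rel1≈s2-s3 : (a b : Fin N) →
    (u b ⊗ u b ⊗ u a ⊝ u b ⊗ u a ⊗ u b) ⊝ (u b ⊗ u a ⊗ u a ⊝ u a ⊗ u b ⊗ u a) ≈ rel1 a b
  rel1≈s2-s3 a b = solve
    ((x₁ ⊗ x₁ ⊗ x₀ ⊝ x₁ ⊗ x₀ ⊗ x₁) ⊝ (x₁ ⊗ x₀ ⊗ x₀ ⊝ x₀ ⊗ x₁ ⊗ x₀)) (rel1 (# 0) (# 1))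
    ≡.refl (lookup (u a ∷ᵛ u b ∷ᵛ ⟨⟩))
    where x₀ x₁ : Expr 2
          x₀ = u (# 0)
          x₁ = u (# 1)

  rel4≈s2-s4 : (a b c : Fin N) → let g = u c ⊗ u c ⊗ u a ⊝ u c ⊗ u a ⊗ u c in
    ⊖ (u b ⊗ g) ⊕ g ⊗ u b ⊕ u c ⊗ rel3 a b c ≈ rel4 a b c
  rel4≈s2-s4 a b c = solve
    (⊖ (x₁ ⊗ g) ⊕ g ⊗ x₁ ⊕ x₂ ⊗ rel3 (# 0) (# 1) (# 2)) (rel4 (# 0) (# 1) (# 2))
    ≡.refl (lookup (u a ∷ᵛ u b ∷ᵛ u c ∷ᵛ ⟨⟩))
    where x₀ x₁ x₂ g : Expr 3
          x₀ = u (# 0)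
          x₁ = u (# 1)
          x₂ = u (# 2)
          g = x₂ ⊗ x₂ ⊗ x₀ ⊝ x₂ ⊗ x₀ ⊗ x₂

  rel1∈I-S : {a b : Fin N} → a < b → I-S N (rel1 a b)
  rel1∈I-S {a} {b} a<b with toℕ b ≟ suc (toℕ a)
  ... | yes b≡1+a = gen (s1 b≡1+a)
  ... | no b≢1+a = resp∈ (rel1≈s2-s3 a b) (add∈ (gen (s2 a+2≤b)) (neg∈ (gen (s3 a+2≤b))))
    where
    a+2≤b : toℕ a ℕ.+ 2 ≤ toℕ b
    a+2≤b = ≤-trans (≤-reflexive (+-comm (toℕ a) 2)) (≤∧≢⇒< a<b (b≢1+a ∘ ≡.sym))

  rel4∈I-S : {a b c : Fin N} → a < b → b < c → I-S N (rel4 a b c)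
  rel4∈I-S {a} {b} {c} a<b b<c = resp∈ (rel4≈s2-s4 a b c)
    (add∈ (add∈ (neg∈ (mulˡ∈ (u b) g∈I-S)) (mulʳ∈ (u b) g∈I-S)) (mulˡ∈ (u c) (gen (s4 a<b b<c))))
    where
    a+2≤c : toℕ a ℕ.+ 2 ≤ toℕ c
    a+2≤c = ≤-trans (≤-reflexive (+-comm (toℕ a) 2)) (≤-trans (s≤s a<b) b<c)
    g∈I-S : I-S N (u c ⊗ u c ⊗ u a ⊝ u c ⊗ u a ⊗ u c)
    g∈I-S = gen (s2 a+2≤c)

  GenC⊆I-S : GenC ⊆ I-S N
  GenC⊆I-S (c1 a<b) = rel1∈I-S a<b
  GenC⊆I-S (c2 a<b b<c) = gen (s4 a<b b<c)
  GenC⊆I-S (c3 a<b b<c) = rel4∈I-S a<b b<c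

lemma2p18 : (N : ℕ) → (p : Expr N) → I-C N p → I-S N p
lemma2p18 N p = ⟨⟩-least GenC⊆I-S
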